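{- Let $G$ be the ordered complete graph on $[n]$. (i) If $n\ge 4$, there exists a $2$-coloring of the edges of $G$ which does not contain a monochromatic separated subtree with more than $\lceil n/2\rceil+1$ vertices. (ii) There exists a $2$-coloring of the edges of $G$ which does not contain a monochromatic nested subtree with more than $\frac{n+4}{2}$ vertices. (iii) There exists a $2$-coloring of the edges of $G$ which does not contain a monochromatic crossing subtree with more than $\frac{n+3}{2}$ vertices.
   Context: The ordered complete graph on $[n]=\{1,\dots,n\}$ is the complete graph with vertex set $[n]$, taken with its natural ordering; edges are written $(i,j)$ with $i<j$. A $2$-coloring assigns one of two colors to each edge; a subgraph is monochromatic if all its edges have the same color. Two edges are independent if they share no vertex. Independent edges $(a,b)$ and $(c,d)$ are crossing if $a<c<b<d$ or $c<a<d<b$; nested if $a<c<d<b$ or $c<a<b<d$; separated if $a<b<c<d$ or $c<d<a<b$. A subgraph is called crossing (resp. nested, separated) if any two of its independent edges are crossing (resp. nested, separated). A subtree is a (not necessarily spanning) subgraph that is a tree. -}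

module Defs where

open import Level using (0ℓ)
open import Data.Bool using (Bool; T)
open import Data.Nat as ℕ using (ℕ)
open import Data.Fin using (Fin; _<_)
open import Data.Fin.Subset using (Subset; _∈_; Nonempty; ∣_∣)
open import Data.Integer using (+_)
open import Data.List using (List; _∷_; _∷ʳ_; length)
open import Data.List.Relation.Unary.Linked using (Linked)
open import Data.List.Relation.Unary.Unique.Propositional using (Unique)
open import Data.Product using (Σ-syntax; ∃; ∃₂; _×_)
open import Data.Rational.Unnormalised using (ℚᵘ; _/_)
open import Data.Sum using (_⊎_)
open import Relation.Binary using (Rel)
open import Relation.Binary.Construct.Closure.ReflexiveTransitive using (Star)
open import Relation.Binary.PropositionalEquality using (_≡_; _≢_)
open import Relation.Nullary using (¬_)

private
  variable
    n : ℕ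

-- The vertex set [n] is Fin n with its usual order (so the labels are
-- shifted down by one).

record Edge (n : ℕ) : Set where
  constructor edge
  field
    lo hi : Fin n
    lo<hi : lo < hi

open Edge public

Coloring : ℕ → Set
Coloring n = Edge n → Bool

Independent : Rel (Edge n) 0ℓ
Independent (edge a b _) (edge c d _) = a ≢ c × a ≢ d × b ≢ c × b ≢ d

Crossing : Rel (Edge n) 0ℓ
Crossing (edge a b _) (edge c d _) =
  (a < c × c < b × b < d) ⊎ (c < a × a < d × d < b)

Nested : Rel (Edge n) 0ℓ
Nested (edge a b _) (edge c d _) =
  (a < c × c < d × d < b) ⊎ (c < a × a < b × b < d)

Separated : Rel (Edge n) 0ℓ
Separated (edge a b _) (edge c d _) =
  (a < b × b < c × c < d) ⊎ (c < d × d < a × a < b)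

record Subgraph (n : ℕ) : Set where
  field
    vertices : Subset n
    edges    : Edge n → Bool

  _∈E : Edge n → Set
  e ∈E = T (edges e)

  field
    lo∈V : ∀ e → e ∈E → lo e ∈ vertices
    hi∈V : ∀ e → e ∈E → hi e ∈ vertices

  Adjacent : Rel (Fin n) 0ℓ
  Adjacent u v = (Σ[ u<v ∈ u < v ] edge u v u<v ∈E)
               ⊎ (Σ[ v<u ∈ v < u ] edge v u v<u ∈E)

  Connected : Set
  Connected = ∀ u v → u ∈ vertices → v ∈ vertices → Star Adjacent u v

  -- The cycle u, v₁, …, vₖ, u with k ≥ 2 and u, v₁, …, vₖ distinct.
  IsCycle : Fin n → List (Fin n) → Set
  IsCycle u vs = 2 ℕ.≤ length vs × Unique (u ∷ vs) × Linked Adjacent (u ∷ (vs ∷ʳ u))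

  Acyclic : Set
  Acyclic = ¬ ∃₂ IsCycle

  IsTree : Set
  IsTree = Nonempty vertices × Connected × Acyclic

  Monochromatic : Coloring n → Set
  Monochromatic χ = ∀ e f → e ∈E → f ∈E → χ e ≡ χ f

  -- With R one of Crossing, Nested, Separated, this says that the subgraph
  -- is crossing, nested, separated.
  IndependentEdgesAre : Rel (Edge n) 0ℓ → Set
  IndependentEdgesAre R = ∀ e f → e ∈E → f ∈E → Independent e f → R e f

  order : ℕ
  order = ∣ vertices ∣

ContainsMonochromaticSubtree : Coloring n → Rel (Edge n) 0ℓ → (ℕ → Set) → Set
ContainsMonochromaticSubtree {n} χ R Size = ∃ λ (H : Subgraph n) →
  let open Subgraph H in
  IsTree × Monochromatic χ × IndependentEdgesAre R × Size order

fromℕ : ℕ → ℚᵘ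
fromℕ k = + k / 1

{-# OPTIONS --safe #-}
module Submission where

-- A tree with k + 1 vertices has a list of k edges reaching all of them, so
-- it suffices to bound the number of edges. Give each edge a natural number
-- so that distinct edges have keys at least d apart while all keys differ by
-- at most m; then there are at most 1 + m / d edges.
--
-- Crossing: colour an edge by the parity of lo + hi and use lo + hi as key.
-- Crossing edges have strictly ordered ends on both sides, and adjacent edges
-- are 2 apart by parity or by strictness. As no two edges are separated, every
-- lo is at most every hi, so the keys spread over at most n - 1.
--
-- Nested: same colouring. If (a , b) is the edge with least hi, and among
-- those with least lo, then every edge contains b or strictly straddles it.
-- Edges at b keep the key lo + hi; straddling edges form a chain and get
-- hi - lo, shifted by a + b + 1 to lie above the keys of the edges at b.
--
-- Separated: colour an edge by whether it joins the two halves of [n]. If not,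
-- the tree stays inside one half. If it does, any two edges share an end, so
-- lo + hi is injective and spreads over less than half of [n].

open import Data.Bool using (Bool; true; false; not)
open import Data.Bool.Properties using (not-¬)
open import Data.Fin as Fin using (Fin; zero; suc; toℕ; fromℕ<; combine; punchOut)
import Data.Fin.Properties as Fin
open import Data.Fin.Subset using (Subset; inside; outside; _∈_; ∣_∣)
open import Data.Fin.Subset.Properties using (_∈?_)
open import Data.Integer using (+_)
import Data.Integer as ℤ
import Data.Integer.Properties as ℤ
open import Data.List using (List; []; _∷_; length; lookup; filter; allFin)
open import Data.List.Extrema.Nat using (argmin; argmin-all; f[argmin]≤f[⊤]; f[argmin]≤f[xs])
open import Data.List.Membership.Propositional using () renaming (_∈_ to _∈ᴸ_)
open import Data.List.Membership.Propositional.Properties using (∈-allFin; ∈-filter⁺; ∈-filter⁻; ∈-lookup)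
open import Data.List.Membership.Setoid.Properties using (index-injective)
open import Data.List.Relation.Unary.All as All using ([]; _∷_)
open import Data.List.Relation.Unary.AllPairs using ([]; _∷_)
open import Data.List.Relation.Unary.Any as Any using (here; there)
open import Data.List.Relation.Unary.Linked using ([-]; _∷_)
open import Data.List.Relation.Unary.Unique.Propositional using (Unique)
open import Data.Nat using (ℕ; zero; suc; _+_; _∸_; _*_; _≤_; _<_; z≤n; s≤s; s≤s⁻¹; ⌊_/2⌋; ⌈_/2⌉; NonZero; _<?_; _≤?_)
import Data.Nat as ℕ
open import Data.Nat.Divisibility using (∣-refl)
import Data.Nat.DivMod as ℕ
open import Data.Nat.Properties
open import Data.Product using (∃; _×_; _,_; proj₁; proj₂)
open import Data.Rational.Unnormalised using (_/_) renaming (_<_ to _<ℚ_)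
open import Data.Rational.Unnormalised.Properties using (drop-*<*)
open import Data.Sum using (_⊎_; inj₁; inj₂; swap; map)
open import Data.Vec using ([]; _∷_; here; there)
open import Function using (_∘_; id; case_of_)
open import Level using (0ℓ)
open import Relation.Binary using (Rel; tri<; tri≈; tri>)
open import Relation.Binary.Construct.Closure.ReflexiveTransitive using (Star; ε; _◅_)
open import Relation.Binary.PropositionalEquality
open import Relation.Nullary using (¬_; Dec; yes; no; does; contradiction; _×-dec_; _⊎-dec_)
open import Defs

-- Counting through injections and spaced keys

-- Induction on the subset: each element uses up one value of `f`, and `punchOut` closes the gap
-- that this leaves in the codomain.
card-≤ : ∀ {n N} (S : Subset n) (f : ∀ v → v ∈ S → Fin N) →
         (∀ {u v} (p : u ∈ S) (q : v ∈ S) → f u p ≡ f v q → u ≡ v) → ∣ S ∣ ≤ N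
card-≤ [] f inj = z≤n
card-≤ (outside ∷ S) f inj =
  card-≤ S (λ v p → f (suc v) (there p))
    (λ p q eq → Fin.suc-injective (inj (there p) (there q) eq))
card-≤ {N = zero} (inside ∷ S) f inj = contradiction (f zero here) λ ()
card-≤ {N = suc N} (inside ∷ S) f inj =
  s≤s (card-≤ S (λ v p → punchOut (0≢ p))
    (λ p q eq → Fin.suc-injective (inj (there p) (there q)
      (Fin.punchOut-injective (0≢ p) (0≢ q) eq))))
  where
  0≢ : ∀ {v} (p : v ∈ S) → f zero here ≢ f (suc v) (there p)
  0≢ p eq = Fin.0≢1+n (inj here (there p) eq)

card-≤-length : ∀ {n} (S : Subset n) (T : List (Fin n)) →
                (∀ {v} → v ∈ S → v ∈ᴸ T) → ∣ S ∣ ≤ length T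
card-≤-length S T S⊆T =
  card-≤ S (λ v p → Any.index (S⊆T p))
    (λ p q → index-injective (setoid _) (S⊆T p) (S⊆T q))

Apart : ℕ → ℕ → ℕ → Set
Apart d x y = d + x ≤ y ⊎ d + y ≤ x

≢⇒Apart : ∀ {x y} → x ≢ y → Apart 1 x y
≢⇒Apart {x} {y} x≢y with <-cmp x y
... | tri< x<y _ _ = inj₁ x<y
... | tri≈ _ x≡y _ = contradiction x≡y x≢y
... | tri> _ _ y<x = inj₂ y<x

quotient-< : ∀ d .{{_ : NonZero d}} {x y} → d + x ≤ y → x ℕ./ d < y ℕ./ d
quotient-< d {x} {y} d+x≤y = begin-strict
  x ℕ./ d            <⟨ n<1+n _ ⟩
  1 + x ℕ./ d        ≡⟨ cong (_+ x ℕ./ d) (ℕ.n/n≡1 d) ⟨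
  d ℕ./ d + x ℕ./ d  ≡⟨ ℕ.+-distrib-/-∣ˡ x ∣-refl ⟨
  (d + x) ℕ./ d      ≤⟨ ℕ./-monoˡ-≤ d d+x≤y ⟩
  y ℕ./ d            ∎
  where open ≤-Reasoning

lookup-injective : ∀ {A : Set} {xs : List A} → Unique xs →
                   ∀ i j → lookup xs i ≡ lookup xs j → i ≡ j
lookup-injective (_ ∷ _)  zero    zero    _  = refl
lookup-injective (x∉ ∷ _) zero    (suc j) eq = contradiction eq (All.lookup x∉ (∈-lookup j))
lookup-injective (x∉ ∷ _) (suc i) zero    eq = contradiction (sym eq) (All.lookup x∉ (∈-lookup i))
lookup-injective (_ ∷ u)  (suc i) (suc j) eq = cong suc (lookup-injective u i j eq)

minimum : ∀ {A : Set} (key : A → ℕ) x xs →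
          ∃ λ y → y ∈ᴸ x ∷ xs × (∀ {z} → z ∈ᴸ x ∷ xs → key y ≤ key z)
minimum key x xs =
  argmin key x xs
  , argmin-all key {P = _∈ᴸ x ∷ xs} (here refl) (All.tabulate there)
  , λ { (here refl) → f[argmin]≤f[⊤] {f = key} x xs
      ; (there z∈) → All.lookup (f[argmin]≤f[xs] {f = key} x xs) z∈ }

-- Subtract the least key and divide by `d`: keys at least `d` apart get different quotients, and no
-- quotient exceeds that of `m`. Multiplying by `d` keeps division out of the conclusion.
spaced-length : ∀ {A : Set} d .{{_ : NonZero d}} m (key : A → ℕ) {xs : List A} → Unique xs →
                (∀ {x y} → x ∈ᴸ xs → y ∈ᴸ xs → key x ≤ key y + m) →
                (∀ {x y} → x ∈ᴸ xs → y ∈ᴸ xs → x ≢ y → Apart d (key x) (key y)) →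
                length xs * d ≤ d + m
spaced-length d m key {[]} _ _ _ = z≤n
spaced-length d m key {xs@(x₀ ∷ xs′)} unique within apart
  with s , s∈ , s≤ ← minimum key x₀ xs′ = begin
  length xs * d          ≤⟨ *-monoˡ-≤ d (Fin.injective⇒≤ {f = code} (λ {i} {j} → code-injective {i} {j})) ⟩
  suc (m ℕ./ d) * d      ≤⟨ +-monoʳ-≤ d (ℕ.m/n*n≤m m d) ⟩
  d + m                  ∎
  where
  open ≤-Reasoning
  val : Fin (length xs) → ℕ
  val i = key (lookup xs i) ∸ key s

  val/d< : ∀ i → val i ℕ./ d < suc (m ℕ./ d)
  val/d< i = s≤s (ℕ./-monoˡ-≤ d (m≤n+o⇒m∸n≤o _ (key s) (within (∈-lookup i) s∈)))

  code : Fin (length xs) → Fin (suc (m ℕ./ d))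
  code i = fromℕ< (val/d< i)

  spread : ∀ i j → d + key (lookup xs i) ≤ key (lookup xs j) → val i ℕ./ d < val j ℕ./ d
  spread i j le = quotient-< d
    (subst (_≤ val j) (+-∸-assoc d (s≤ (∈-lookup i))) (∸-monoˡ-≤ (key s) le))

  code-injective : ∀ {i j} → code i ≡ code j → i ≡ j
  code-injective {i} {j} eq with i Fin.≟ j
  ... | yes i≡j = i≡j
  ... | no i≢j with apart (∈-lookup i) (∈-lookup j) (i≢j ∘ lookup-injective unique i j)
  ... | inj₁ le = contradiction (Fin.fromℕ<-injective _ _ (val/d< i) (val/d< j) eq) (<⇒≢ (spread i j le))
  ... | inj₂ le = contradiction (sym (Fin.fromℕ<-injective _ _ (val/d< i) (val/d< j) eq)) (<⇒≢ (spread j i le))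

-- Edge lists of trees

module _ {n : ℕ} (H : Subgraph n) where
  open Subgraph H

  -- Invariant of growth from a root: `T` lists the vertices reached so far, and `treeEdges` has one
  -- edge for each of them but the root.
  record Grown (T : List (Fin n)) : Set where
    field
      treeEdges : List (Edge n)
      unique    : Unique treeEdges
      ⊆E        : ∀ {e} → e ∈ᴸ treeEdges → e ∈E
      ends      : ∀ {e} → e ∈ᴸ treeEdges → lo e ∈ᴸ T × hi e ∈ᴸ T
      size      : length T ≡ suc (length treeEdges)
  open Grown

  -- The new edge differs from all earlier ones, since those have both ends in `T` and it has the
  -- end `v` outside.
  extend : ∀ {v T} → ¬ (v ∈ᴸ T) → (G : Grown T) → ∀ e → e ∈E →
           (v ≡ lo e × hi e ∈ᴸ T) ⊎ (v ≡ hi e × lo e ∈ᴸ T) → Grown (v ∷ T)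
  extend {v} {T} v∉T G e e∈E e-ends = record
    { treeEdges = e ∷ treeEdges G
    ; unique = All.tabulate (λ {f} f∈ e≡f → e∉ (subst (_∈ᴸ treeEdges G) (sym e≡f) f∈)) ∷ unique G
    ; ⊆E = λ { (here refl) → e∈E ; (there f∈) → ⊆E G f∈ }
    ; ends = λ { (here refl) → ends-e e-ends
               ; (there f∈) → there (proj₁ (ends G f∈)) , there (proj₂ (ends G f∈)) }
    ; size = cong suc (size G)
    }
    where
    e∉ : ¬ (e ∈ᴸ treeEdges G)
    e∉ e∈ = case e-ends of λ
      { (inj₁ (v≡lo , _)) → v∉T (subst (_∈ᴸ T) (sym v≡lo) (proj₁ (ends G e∈)))
      ; (inj₂ (v≡hi , _)) → v∉T (subst (_∈ᴸ T) (sym v≡hi) (proj₂ (ends G e∈))) }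

    ends-e : (v ≡ lo e × hi e ∈ᴸ T) ⊎ (v ≡ hi e × lo e ∈ᴸ T) → lo e ∈ᴸ v ∷ T × hi e ∈ᴸ v ∷ T
    ends-e (inj₁ (refl , hi∈)) = here refl , there hi∈
    ends-e (inj₂ (refl , lo∈)) = there lo∈ , here refl

  _∈ᴸ?_ : ∀ (v : Fin n) T → Dec (v ∈ᴸ T)
  v ∈ᴸ? T = Any.any? (v Fin.≟_) T

  -- The path is absorbed from `r` backwards, so each new vertex is adjacent to one already reached.
  growTo : ∀ {r v T} → Star Adjacent v r → r ∈ᴸ T → Grown T →
           ∃ λ T′ → (∀ {u} → u ∈ᴸ T → u ∈ᴸ T′) × v ∈ᴸ T′ × Grown T′
  growTo {T = T} ε r∈T G = T , id , r∈T , G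
  growTo {v = v} (v~w ◅ w⋆) r∈T G with growTo w⋆ r∈T G
  ... | T , T⊆ , w∈T , G′ with v ∈ᴸ? T
  ... | yes v∈T = T , T⊆ , v∈T , G′
  ... | no v∉T = v ∷ T , there ∘ T⊆ , here refl , (case v~w of λ
    { (inj₁ (v<w , e∈E)) → extend v∉T G′ (edge _ _ v<w) e∈E (inj₁ (refl , w∈T))
    ; (inj₂ (w<v , e∈E)) → extend v∉T G′ (edge _ _ w<v) e∈E (inj₂ (refl , w∈T)) })

  growAll : ∀ {r} → (vs : List (Fin n)) → (∀ {v} → v ∈ᴸ vs → Star Adjacent v r) →
            ∃ λ T → r ∈ᴸ T × (∀ {v} → v ∈ᴸ vs → v ∈ᴸ T) × Grown T
  growAll {r} [] _ = r ∷ [] , here refl , (λ ()) , record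
    { treeEdges = [] ; unique = [] ; ⊆E = λ () ; ends = λ () ; size = refl }
  growAll (v ∷ vs) path with growAll vs (path ∘ there)
  ... | T , r∈T , vs⊆T , G with growTo (path (here refl)) r∈T G
  ... | T′ , T⊆T′ , v∈T′ , G′ =
    T′ , T⊆T′ r∈T , (λ { (here refl) → v∈T′ ; (there u∈) → T⊆T′ (vs⊆T u∈) }) , G′

  spanningTree : IsTree → ∃ λ (F : List (Edge n)) →
                 Unique F × (∀ {e} → e ∈ᴸ F → e ∈E) × order ≤ suc (length F)
  spanningTree ((r , r∈V) , connected , _)
    with growAll (filter (_∈? vertices) (allFin n))
           (λ v∈ → connected _ r (proj₂ (∈-filter⁻ (_∈? vertices) {xs = allFin n} v∈)) r∈V)
  ... | T , _ , V⊆T , G = treeEdges G , unique G , ⊆E G ,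
    subst (order ≤_) (size G)
      (card-≤-length vertices T (λ v∈V → V⊆T (∈-filter⁺ (_∈? vertices) (∈-allFin _) v∈V)))

-- Edge sums and the parity colouring

witness : ∀ {P : Set} (P? : Dec P) → does P? ≡ true → P
witness (yes p) _ = p

refute : ∀ {P : Set} (P? : Dec P) → does P? ≡ false → ¬ P
refute (no ¬p) _ = ¬p

parity : ℕ → Bool
parity zero    = true
parity (suc x) = not (parity x)

parity-gap : ∀ {x y} → parity x ≡ parity y → x < y → 2 + x ≤ y
parity-gap eq x<y with m≤n⇒m<n∨m≡n x<y
... | inj₁ 1+x<y = 1+x<y
... | inj₂ refl  = contradiction eq (not-¬ refl)

parity-apart : ∀ {x y} → parity x ≡ parity y → x ≢ y → Apart 2 x y
parity-apart eq x≢y = map (parity-gap eq) (parity-gap (sym eq)) (≢⇒Apart x≢y)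

+-mono-<-2 : ∀ {x x′ y y′} → x < x′ → y < y′ → 2 + (x + y) ≤ x′ + y′
+-mono-<-2 {x} {x′} {y} {y′} x<x′ y<y′ =
  subst (_≤ x′ + y′) (cong suc (+-suc x y)) (+-mono-≤ x<x′ y<y′)

edge-≡ : ∀ {n} {e f : Edge n} → lo e ≡ lo f → hi e ≡ hi f → e ≡ f
edge-≡ {e = edge a b p} {edge .a .b q} refl refl = cong (edge a b) (<-irrelevant p q)

sum : ∀ {n} → Edge n → ℕ
sum e = toℕ (lo e) + toℕ (hi e)

sum-injective-lo : ∀ {n} {e f : Edge n} → lo e ≡ lo f → sum e ≡ sum f → e ≡ f
sum-injective-lo {e = e} refl eq = edge-≡ refl (Fin.toℕ-injective (+-cancelˡ-≡ (toℕ (lo e)) _ _ eq))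

sum-injective-hi : ∀ {n} {e f : Edge n} → hi e ≡ hi f → sum e ≡ sum f → e ≡ f
sum-injective-hi {e = e} refl eq = edge-≡ (Fin.toℕ-injective (+-cancelʳ-≡ (toℕ (hi e)) _ _ eq)) refl

Shares : ∀ {n} → Rel (Edge n) 0ℓ
Shares e f = lo e ≡ lo f ⊎ lo e ≡ hi f ⊎ hi e ≡ lo f ⊎ hi e ≡ hi f

shares⊎independent : ∀ {n} (e f : Edge n) → Shares e f ⊎ Independent e f
shares⊎independent e f with lo e Fin.≟ lo f | lo e Fin.≟ hi f | hi e Fin.≟ lo f | hi e Fin.≟ hi f
... | yes p | _     | _     | _     = inj₁ (inj₁ p)
... | no _  | yes p | _     | _     = inj₁ (inj₂ (inj₁ p))
... | no _  | no _  | yes p | _     = inj₁ (inj₂ (inj₂ (inj₁ p)))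
... | no _  | no _  | no _  | yes p = inj₁ (inj₂ (inj₂ (inj₂ p)))
... | no p  | no q  | no r  | no s  = inj₂ (p , q , r , s)

parityColoring : ∀ {n} → Coloring n
parityColoring e = parity (sum e)

-- Distinct edges with a common low end or a common high end have different sums, and equal parity
-- widens the gap to 2. If one edge ends where the other begins, both ends move strictly, which
-- gives 2 at once.
shares⇒sum-apart : ∀ {n} {e f : Edge n} → e ≢ f → parityColoring e ≡ parityColoring f →
                   Shares e f → Apart 2 (sum e) (sum f)
shares⇒sum-apart e≢f eq (inj₁ p) = parity-apart eq (e≢f ∘ sum-injective-lo p)
shares⇒sum-apart {e = e} {f} e≢f eq (inj₂ (inj₁ refl)) = inj₂ (+-mono-<-2 (lo<hi f) (lo<hi e))
shares⇒sum-apart {e = e} {f} e≢f eq (inj₂ (inj₂ (inj₁ refl))) = inj₁ (+-mono-<-2 (lo<hi e) (lo<hi f))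
shares⇒sum-apart e≢f eq (inj₂ (inj₂ (inj₂ p))) = parity-apart eq (e≢f ∘ sum-injective-hi p)

crossing⇒sum-apart : ∀ {n} {e f : Edge n} → Crossing e f → Apart 2 (sum e) (sum f)
crossing⇒sum-apart (inj₁ (a<c , _ , b<d)) = inj₁ (+-mono-<-2 a<c b<d)
crossing⇒sum-apart (inj₂ (c<a , _ , d<b)) = inj₂ (+-mono-<-2 c<a d<b)

-- Overlapping edges and the bound for crossing trees

Overlapping : ∀ {n} → Rel (Edge n) 0ℓ → Set
Overlapping R = ∀ e f → R e f → lo e Fin.< hi f

crossing-overlapping : ∀ {n} → Overlapping (Crossing {n})
crossing-overlapping e f (inj₁ (a<c , _ , _)) = Fin.<-trans a<c (lo<hi f)
crossing-overlapping e f (inj₂ (_ , a<d , _)) = a<d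

nested-overlapping : ∀ {n} → Overlapping (Nested {n})
nested-overlapping e f (inj₁ (a<c , c<d , _)) = Fin.<-trans a<c c<d
nested-overlapping e f (inj₂ (_ , a<b , b<d)) = Fin.<-trans a<b b<d

module _ {n : ℕ} (H : Subgraph n) where
  open Subgraph H

  -- Were `f` entirely to the left of `e`, the two would be independent, hence related by `R`, hence
  -- overlapping.
  lo≤hi : ∀ {R} → Overlapping R → IndependentEdgesAre R →
          ∀ {e f} → e ∈E → f ∈E → toℕ (lo e) ≤ toℕ (hi f)
  lo≤hi overlapping independent {e} {f} e∈E f∈E = ≮⇒≥ λ hif<loe →
    <-asym hif<loe (overlapping e f (independent e f e∈E f∈E
      ( ≢-sym (Fin.<⇒≢ (Fin.<-trans (lo<hi f) hif<loe))
      , ≢-sym (Fin.<⇒≢ hif<loe)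
      , ≢-sym (Fin.<⇒≢ (Fin.<-trans (Fin.<-trans (lo<hi f) hif<loe) (lo<hi e)))
      , ≢-sym (Fin.<⇒≢ (Fin.<-trans hif<loe (lo<hi e))))))

-- Passes from edges to vertices with everything doubled, which avoids halves of odd numbers.
≤suc⇒*2≤ : ∀ {v k m} → v ≤ suc k → k * 2 ≤ 2 + m → v * 2 ≤ 4 + m
≤suc⇒*2≤ v≤ k*2≤ = ≤-trans (*-monoˡ-≤ 2 v≤) (s≤s (s≤s k*2≤))

crossing-order : ∀ {n} (H : Subgraph n) → let open Subgraph H in
                 IsTree → Monochromatic parityColoring → IndependentEdgesAre Crossing →
                 order * 2 ≤ 3 + n
crossing-order {zero} H ((() , _) , _)
crossing-order {suc n} H tree mono crossing with spanningTree H tree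
... | F , unique , F⊆E , order≤ =
  -- There are `suc n` vertices here: the spread `n` is the largest label, and `4 + n` is the
  -- required `3 + suc n`.
  ≤suc⇒*2≤ order≤ (spaced-length 2 n sum unique
    (λ {e} {f} e∈ f∈ → begin
      toℕ (lo e) + toℕ (hi e)  ≤⟨ +-mono-≤ (lo≤hi H crossing-overlapping crossing (F⊆E e∈) (F⊆E f∈))
                                           (Fin.toℕ≤pred[n] (hi e)) ⟩
      toℕ (hi f) + n           ≤⟨ +-monoˡ-≤ n (m≤n+m _ (toℕ (lo f))) ⟩
      sum f + n                ∎)
    (λ {e} {f} e∈ f∈ e≢f → case shares⊎independent e f of λ
      { (inj₁ sh) → shares⇒sum-apart e≢f (mono e f (F⊆E e∈) (F⊆E f∈)) sh
      ; (inj₂ ind) → crossing⇒sum-apart {e = e} {f} (crossing e f (F⊆E e∈) (F⊆E f∈) ind) }))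
  where open ≤-Reasoning

-- Separated trees and the cut into halves

straddles? : ∀ {n} (m : ℕ) (e : Edge n) → Dec (toℕ (lo e) < m × m ≤ toℕ (hi e))
straddles? m e = (toℕ (lo e) <? m) ×-dec (m ≤? toℕ (hi e))

halvesColoring : ∀ {n} → ℕ → Coloring n
halvesColoring m e = does (straddles? m e)

module _ {n : ℕ} (H : Subgraph n) (h : ℕ) (n≤2m : n ≤ suc h + suc h) where
  open Subgraph H

  private
    -- The cut is a successor because `h`, one less than `m`, will bound the spread of the sums. By
    -- `n≤2m` the upper side also has at most `m` vertices.
    m : ℕ
    m = suc h

  -- Adjacent vertices lie on the same side of the cut, so a path to `r` puts every vertex on the
  -- side of `r`.
  unsplit-half-order : IsTree → (∀ e → e ∈E → ¬ (toℕ (lo e) < m × m ≤ toℕ (hi e))) → order ≤ m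
  unsplit-half-order ((r , r∈V) , connected , _) unsplit with toℕ r <? m
  ... | yes r<m = card-≤ vertices (λ v v∈ → fromℕ< (below (connected v r v∈ r∈V)))
    (λ p q eq → Fin.toℕ-injective (Fin.fromℕ<-injective _ _ _ _ eq))
    where
    below : ∀ {v} → Star Adjacent v r → toℕ v < m
    below ε = r<m
    below (inj₁ (v<w , e∈E) ◅ w⋆) = <-trans v<w (below w⋆)
    below (inj₂ (w<v , e∈E) ◅ w⋆) = ≰⇒> λ m≤v → unsplit _ e∈E (below w⋆ , m≤v)
  ... | no r≮m = card-≤ vertices
    (λ v v∈ → fromℕ< {m = toℕ v ∸ m} (m<n+o⇒m∸n<o (toℕ v) m (<-≤-trans (Fin.toℕ<n v) n≤2m)))
    (λ {u} {v} u∈ v∈ eq → Fin.toℕ-injective (∸-cancelʳ-≡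
      (above (connected u r u∈ r∈V)) (above (connected v r v∈ r∈V))
      (Fin.fromℕ<-injective _ _ _ _ eq)))
    where
    above : ∀ {v} → Star Adjacent v r → m ≤ toℕ v
    above ε = ≮⇒≥ r≮m
    above (inj₁ (v<w , e∈E) ◅ w⋆) = ≮⇒≥ λ v<m → unsplit _ e∈E (v<m , above w⋆)
    above (inj₂ (w<v , e∈E) ◅ w⋆) = ≤-trans (above w⋆) (<⇒≤ w<v)

  -- A low end and a high end lie on different sides of the cut and cannot coincide; two separated
  -- edges cannot both straddle it.
  straddling-shares : IndependentEdgesAre Separated →
    (∀ e → e ∈E → toℕ (lo e) < m × m ≤ toℕ (hi e)) →
    ∀ {e f} → e ∈E → f ∈E → lo e ≡ lo f ⊎ hi e ≡ hi f
  straddling-shares separated straddle {e} {f} e∈E f∈E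
    with straddle e e∈E | straddle f f∈E | shares⊎independent e f
  ... | _ | _ | inj₁ (inj₁ p) = inj₁ p
  ... | loe<m , _ | _ , m≤hif | inj₁ (inj₂ (inj₁ refl)) = contradiction m≤hif (<⇒≱ loe<m)
  ... | _ , m≤hie | lof<m , _ | inj₁ (inj₂ (inj₂ (inj₁ refl))) = contradiction m≤hie (<⇒≱ lof<m)
  ... | _ | _ | inj₁ (inj₂ (inj₂ (inj₂ p))) = inj₂ p
  ... | loe<m , m≤hie | lof<m , m≤hif | inj₂ ind with separated e f e∈E f∈E ind
  ... | inj₁ (_ , hie<lof , _) = contradiction m≤hie (<⇒≱ (<-trans hie<lof lof<m))
  ... | inj₂ (_ , hif<loe , _) = contradiction m≤hif (<⇒≱ (<-trans hif<loe loe<m))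

  separated-order : IsTree → Monochromatic (halvesColoring m) → IndependentEdgesAre Separated →
                    order ≤ m + 1
  separated-order tree mono separated with spanningTree H tree
  ... | [] , _ , _ , order≤ = ≤-trans order≤ (s≤s z≤n)
  -- The colour of a single edge decides whether all edges straddle the cut or none does.
  ... | F@(e₀ ∷ _) , unique , F⊆E , order≤ with halvesColoring m e₀ in χe₀
  ... | false = ≤-trans (unsplit-half-order tree
    (λ e e∈E → refute (straddles? m e) (trans (mono e e₀ e∈E (F⊆E (here refl))) χe₀))) (m≤m+n m 1)
  -- Spacing 1 and spread `h` allow `1 + h = m` edges, hence `m + 1` vertices.
  ... | true = ≤-trans order≤ (subst (suc (length F) ≤_) (+-comm 1 m) (s≤s
    (subst (_≤ m) (*-identityʳ (length F)) (spaced-length 1 h sum unique within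
      (λ e∈ f∈ e≢f → ≢⇒Apart (λ eq → e≢f (case sharing (F⊆E e∈) (F⊆E f∈) of λ
        { (inj₁ p) → sum-injective-lo p eq ; (inj₂ p) → sum-injective-hi p eq })))))))
    where
    open ≤-Reasoning
    straddle : ∀ e → e ∈E → toℕ (lo e) < m × m ≤ toℕ (hi e)
    straddle e e∈E = witness (straddles? m e) (trans (mono e e₀ e∈E (F⊆E (here refl))) χe₀)

    sharing : ∀ {e f} → e ∈E → f ∈E → lo e ≡ lo f ⊎ hi e ≡ hi f
    sharing = straddling-shares separated straddle

    -- With a common low end, both high ends lie between `m` and `h + m`; with a common high end,
    -- both low ends lie between 0 and `h`.
    within : ∀ {e f} → e ∈ᴸ F → f ∈ᴸ F → sum e ≤ sum f + h
    within {e} {f} e∈ f∈ with sharing (F⊆E e∈) (F⊆E f∈)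
    ... | inj₁ refl = begin
      toℕ (lo e) + toℕ (hi e)        ≤⟨ +-monoʳ-≤ (toℕ (lo e)) (s≤s⁻¹ (<-≤-trans (Fin.toℕ<n (hi e)) n≤2m)) ⟩
      toℕ (lo e) + (h + m)           ≤⟨ +-monoʳ-≤ (toℕ (lo e)) (+-monoʳ-≤ h (proj₂ (straddle f (F⊆E f∈)))) ⟩
      toℕ (lo e) + (h + toℕ (hi f))  ≡⟨ cong (toℕ (lo e) ℕ.+_) (+-comm h _) ⟩
      toℕ (lo e) + (toℕ (hi f) + h)  ≡⟨ +-assoc (toℕ (lo e)) _ h ⟨
      sum f + h                      ∎
    ... | inj₂ refl = begin
      toℕ (lo e) + toℕ (hi e)  ≤⟨ +-monoˡ-≤ (toℕ (hi e)) (s≤s⁻¹ (proj₁ (straddle e (F⊆E e∈)))) ⟩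
      h + toℕ (hi e)           ≡⟨ +-comm h _ ⟩
      toℕ (hi e) + h           ≤⟨ +-monoˡ-≤ h (m≤n+m _ (toℕ (lo f))) ⟩
      sum f + h                ∎

-- The lexicographically least edge and gaps between widths

-- `combine` sends the pair to `n * hi + lo`, so comparing ranks is comparing lexicographically with
-- `hi` first.
lexMinimum : ∀ {n} (e : Edge n) (F : List (Edge n)) → ∃ λ e₀ → e₀ ∈ᴸ e ∷ F ×
             (∀ {f} → f ∈ᴸ e ∷ F → hi e₀ Fin.< hi f ⊎ (hi e₀ ≡ hi f × lo e₀ Fin.≤ lo f))
lexMinimum {n} e F with minimum rank e F
  where
  rank : Edge n → ℕ
  rank f = toℕ (combine (hi f) (lo f))
... | e₀ , e₀∈ , rank≤ = e₀ , e₀∈ , least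
  where
  least : ∀ {f} → f ∈ᴸ e ∷ F → hi e₀ Fin.< hi f ⊎ (hi e₀ ≡ hi f × lo e₀ Fin.≤ lo f)
  least {f} f∈ with Fin.<-cmp (hi e₀) (hi f)
  ... | tri< lt _ _ = inj₁ lt
  ... | tri> _ _ gt = contradiction (Fin.combine-monoˡ-< (lo f) (lo e₀) gt) (≤⇒≯ (rank≤ f∈))
  ... | tri≈ _ refl _ = inj₂ (refl , +-cancelˡ-≤ (n * toℕ (hi f)) _ _
    (subst₂ _≤_ (Fin.toℕ-combine (hi f) (lo e₀)) (Fin.toℕ-combine (hi f) (lo f)) (rank≤ f∈)))

-- Moves truncated subtraction out of the hypothesis, so that gaps between widths follow from plain
-- sums.
length-gap : ∀ {d l h l′ h′} → l ≤ h → l′ ≤ h′ → d + (h + l′) ≤ h′ + l → d + (h ∸ l) ≤ h′ ∸ l′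
length-gap {d} {l} {h} {l′} {h′} l≤h l′≤h′ le = m+n≤o⇒m≤o∸n (d + (h ∸ l)) (+-cancelʳ-≤ l _ _ (begin
  d + (h ∸ l) + l′ + l    ≡⟨ +-assoc (d + (h ∸ l)) l′ l ⟩
  d + (h ∸ l) + (l′ + l)  ≡⟨ cong ((d + (h ∸ l)) ℕ.+_) (+-comm l′ l) ⟩
  d + (h ∸ l) + (l + l′)  ≡⟨ +-assoc (d + (h ∸ l)) l l′ ⟨
  d + (h ∸ l) + l + l′    ≡⟨ cong (_+ l′) (+-assoc d (h ∸ l) l) ⟩
  d + (h ∸ l + l) + l′    ≡⟨ cong (λ x → d + x + l′) (m∸n+n≡m l≤h) ⟩
  d + h + l′              ≡⟨ +-assoc d h l′ ⟩
  d + (h + l′)            ≤⟨ le ⟩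
  h′ + l                  ∎))
  where open ≤-Reasoning

width : ∀ {n} → Edge n → ℕ
width e = toℕ (hi e) ∸ toℕ (lo e)

lo≤hi-self : ∀ {n} (e : Edge n) → toℕ (lo e) ≤ toℕ (hi e)
lo≤hi-self e = <⇒≤ (lo<hi e)

-- The outer edge exceeds the inner one by at least 1 at each end.
nested⇒width-apart : ∀ {n} {e f : Edge n} → Nested e f → Apart 2 (width e) (width f)
nested⇒width-apart {e = e} {f} (inj₁ (a<c , _ , d<b)) =
  inj₂ (length-gap (lo≤hi-self f) (lo≤hi-self e) (+-mono-<-2 d<b a<c))
nested⇒width-apart {e = e} {f} (inj₂ (c<a , _ , b<d)) =
  inj₁ (length-gap (lo≤hi-self e) (lo≤hi-self f) (+-mono-<-2 b<d c<a))

sum-gap-flip : ∀ {n} (e f : Edge n) → 2 + sum e ≤ sum f →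
               2 + (toℕ (hi e) + toℕ (lo e)) ≤ toℕ (hi f) + toℕ (lo f)
sum-gap-flip e f = subst₂ (λ x y → 2 + x ≤ y) (+-comm (toℕ (lo e)) _) (+-comm (toℕ (lo f)) _)

shares-lo⇒width-apart : ∀ {n} {e f : Edge n} → e ≢ f → parityColoring e ≡ parityColoring f →
                        lo e ≡ lo f → Apart 2 (width e) (width f)
shares-lo⇒width-apart {e = e} {f} e≢f eq refl =
  map (length-gap (lo≤hi-self e) (lo≤hi-self f) ∘ sum-gap-flip e f)
      (length-gap (lo≤hi-self f) (lo≤hi-self e) ∘ sum-gap-flip f e)
      (shares⇒sum-apart e≢f eq (inj₁ refl))

-- With a common high end the larger sum belongs to the shorter edge, hence the `swap`.
shares-hi⇒width-apart : ∀ {n} {e f : Edge n} → e ≢ f → parityColoring e ≡ parityColoring f →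
                        hi e ≡ hi f → Apart 2 (width e) (width f)
shares-hi⇒width-apart {e = e} {f} e≢f eq refl =
  swap (map (length-gap (lo≤hi-self f) (lo≤hi-self e) ∘ sum-gap-flip e f)
            (length-gap (lo≤hi-self e) (lo≤hi-self f) ∘ sum-gap-flip f e)
            (shares⇒sum-apart e≢f eq (inj₂ (inj₂ (inj₂ refl)))))

-- The key for nested trees and its bound

module _ {n : ℕ} (H : Subgraph n) where
  open Subgraph H

  triangle-free : Acyclic → ∀ {a b c} (a<b : a Fin.< b) (b<c : b Fin.< c) (a<c : a Fin.< c) →
                  edge a b a<b ∈E → edge b c b<c ∈E → ¬ (edge a c a<c ∈E)
  triangle-free acyclic {a} {b} {c} a<b b<c a<c ab bc ac = acyclic
    ( a , b ∷ c ∷ [] , s≤s (s≤s z≤n)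
    , (Fin.<⇒≢ a<b ∷ Fin.<⇒≢ a<c ∷ []) ∷ (Fin.<⇒≢ b<c ∷ []) ∷ [] ∷ []
    , inj₁ (a<b , ab) ∷ inj₁ (b<c , bc) ∷ inj₂ (a<c , ac) ∷ [-] )

  module NestedKey (acyclic : Acyclic) (mono : Monochromatic parityColoring)
                   (nested : IndependentEdgesAre Nested)
                   (F : List (Edge n)) (F⊆E : ∀ {e} → e ∈ᴸ F → e ∈E)
                   (e₀ : Edge n) (e₀∈ : e₀ ∈ᴸ F)
                   (least : ∀ {f} → f ∈ᴸ F →
                            hi e₀ Fin.< hi f ⊎ (hi e₀ ≡ hi f × lo e₀ Fin.≤ lo f)) where

    private
      a b : Fin n
      a = lo e₀
      b = hi e₀

      A B : ℕ
      A = toℕ a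
      B = toℕ b

    At : Edge n → Set
    At e = lo e ≡ b ⊎ hi e ≡ b

    at? : ∀ e → Dec (At e)
    at? e = (lo e Fin.≟ b) ⊎-dec (hi e Fin.≟ b)

    -- The decision is an argument so that proofs about two edges can match on both decisions.
    keyBy : ∀ e → Dec (At e) → ℕ
    keyBy e (yes _) = sum e
    keyBy e (no _)  = width e + suc (A + B)

    key : Edge n → ℕ
    key e = keyBy e (at? e)

    lo≤hiᶠ : ∀ {e f} → e ∈ᴸ F → f ∈ᴸ F → toℕ (lo e) ≤ toℕ (hi f)
    lo≤hiᶠ e∈ f∈ = lo≤hi H nested-overlapping nested (F⊆E e∈) (F⊆E f∈)

    lo<b : ∀ {f} → f ∈ᴸ F → ¬ At f → toℕ (lo f) < B
    lo<b f∈ ¬at = ≤∧≢⇒< (lo≤hiᶠ f∈ e₀∈) (¬at ∘ inj₁ ∘ Fin.toℕ-injective)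

    b<hi : ∀ {f} → f ∈ᴸ F → ¬ At f → B < toℕ (hi f)
    b<hi f∈ ¬at with least f∈
    ... | inj₁ b<hi = b<hi
    ... | inj₂ (b≡hi , _) = contradiction (inj₂ (sym b≡hi)) ¬at

    -- Unless `f` starts at `a`, it is independent of `e₀`; as it reaches beyond `b`, it must be the
    -- outer edge of the nested pair.
    straddling-lo : ∀ {f} → f ∈ᴸ F → ¬ At f → toℕ (lo f) ≤ A
    straddling-lo {f} f∈ ¬at with shares⊎independent f e₀
    ... | inj₁ (inj₁ refl) = ≤-refl
    ... | inj₁ (inj₂ (inj₁ lo≡b)) = contradiction (inj₁ lo≡b) ¬at
    ... | inj₁ (inj₂ (inj₂ (inj₁ hi≡a))) =
      contradiction (<-trans (lo<hi e₀) (b<hi f∈ ¬at)) (<-irrefl (sym (cong toℕ hi≡a)))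
    ... | inj₁ (inj₂ (inj₂ (inj₂ hi≡b))) = contradiction (inj₂ hi≡b) ¬at
    ... | inj₂ ind with nested f e₀ (F⊆E f∈) (F⊆E e₀∈) ind
    ... | inj₁ (lo<a , _ , _) = <⇒≤ lo<a
    ... | inj₂ (_ , _ , hi<b) = contradiction hi<b (<-asym (b<hi f∈ ¬at))

    -- As `f` starts before `b`, where `e` starts, `e` can only be the inner edge of a nested pair.
    straddling-hi : ∀ {e f} → e ∈ᴸ F → f ∈ᴸ F → lo e ≡ b → ¬ At f → toℕ (hi e) ≤ toℕ (hi f)
    straddling-hi {e} {f} e∈ f∈ refl ¬at with shares⊎independent e f
    ... | inj₁ (inj₁ lo≡lo) = contradiction (inj₁ (sym lo≡lo)) ¬at
    ... | inj₁ (inj₂ (inj₁ b≡hi)) = contradiction (inj₂ (sym b≡hi)) ¬at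
    ... | inj₁ (inj₂ (inj₂ (inj₁ hi≡lo))) =
      contradiction (<-trans (lo<b f∈ ¬at) (lo<hi e)) (<-irrefl (sym (cong toℕ hi≡lo)))
    ... | inj₁ (inj₂ (inj₂ (inj₂ hi≡hi))) = ≤-reflexive (cong toℕ hi≡hi)
    ... | inj₂ ind with nested e f (F⊆E e∈) (F⊆E f∈) ind
    ... | inj₁ (b<lo , _ , _) = contradiction b<lo (<-asym (lo<b f∈ ¬at))
    ... | inj₂ (_ , _ , hi<hi) = <⇒≤ hi<hi

    -- Excludes the one case in which the key of a straddling edge would be only
    -- one above that of an edge at b.
    no-triangle : ∀ {e f} → e ∈ᴸ F → f ∈ᴸ F → lo e ≡ b → lo f ≡ a → hi e ≢ hi f
    no-triangle {e} {f} e∈ f∈ refl refl refl =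
      triangle-free acyclic (lo<hi e₀) (lo<hi e) (lo<hi f) (F⊆E e₀∈) (F⊆E e∈) (F⊆E f∈)

    -- Adding `lo f` clears the subtraction in `width f` and leaves `bound`. If `e` ends at `b`,
    -- strictness comes from `lo e < b < hi f`. If `e` starts at `b`, then `hi e ≤ hi f` and
    -- `lo f ≤ a`, and equality in both would close a triangle.
    at<straddling : ∀ {e f} → e ∈ᴸ F → f ∈ᴸ F → At e → ¬ At f →
                    2 + sum e ≤ width f + suc (A + B)
    at<straddling {e} {f} e∈ f∈ at ¬at = +-cancelʳ-≤ (toℕ (lo f)) _ _ (begin
      2 + (sum e + toℕ (lo f))                       ≤⟨ s≤s (bound at) ⟩
      suc (toℕ (hi f) + (A + B))                     ≡⟨ cong (λ x → suc (x + (A + B))) (m∸n+n≡m (lo≤hi-self f)) ⟨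
      suc (width f + toℕ (lo f) + (A + B))           ≡⟨ +-suc (width f + toℕ (lo f)) (A + B) ⟨
      width f + toℕ (lo f) + suc (A + B)             ≡⟨ +-assoc (width f) (toℕ (lo f)) _ ⟩
      width f + (toℕ (lo f) + suc (A + B))           ≡⟨ cong (width f ℕ.+_) (+-comm (toℕ (lo f)) _) ⟩
      width f + (suc (A + B) + toℕ (lo f))           ≡⟨ +-assoc (width f) _ _ ⟨
      width f + suc (A + B) + toℕ (lo f)             ∎)
      where
      open ≤-Reasoning
      bound : At e → sum e + toℕ (lo f) < toℕ (hi f) + (A + B)
      bound (inj₂ refl) = begin-strict
        toℕ (lo e) + B + toℕ (lo f)    ≡⟨ +-assoc (toℕ (lo e)) B _ ⟩
        toℕ (lo e) + (B + toℕ (lo f))  <⟨ +-mono-<-≤ (<-trans (lo<hi e) (b<hi f∈ ¬at)) (+-monoʳ-≤ B (straddling-lo f∈ ¬at)) ⟩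
        toℕ (hi f) + (B + A)           ≡⟨ cong (toℕ (hi f) ℕ.+_) (+-comm B A) ⟩
        toℕ (hi f) + (A + B)           ∎
      bound (inj₁ refl) = begin-strict
        B + toℕ (hi e) + toℕ (lo f)    ≡⟨ +-assoc B (toℕ (hi e)) _ ⟩
        B + (toℕ (hi e) + toℕ (lo f))  <⟨ +-monoʳ-< B hi+lo< ⟩
        B + (toℕ (hi f) + A)           ≡⟨ +-comm B _ ⟩
        toℕ (hi f) + A + B             ≡⟨ +-assoc (toℕ (hi f)) A B ⟩
        toℕ (hi f) + (A + B)           ∎
        where
        hi≤ = straddling-hi e∈ f∈ refl ¬at
        hi+lo< : toℕ (hi e) + toℕ (lo f) < toℕ (hi f) + A
        hi+lo< with m≤n⇒m<n∨m≡n hi≤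
        ... | inj₁ hi< = +-mono-<-≤ hi< (straddling-lo f∈ ¬at)
        ... | inj₂ hi≡ = +-mono-≤-< hi≤ (≤∧≢⇒< (straddling-lo f∈ ¬at)
          (λ lo≡ → no-triangle e∈ f∈ refl (Fin.toℕ-injective lo≡) (Fin.toℕ-injective hi≡)))

    at-shares : ∀ {e f} → At e → At f → Shares e f
    at-shares (inj₁ p) (inj₁ q) = inj₁ (trans p (sym q))
    at-shares (inj₁ p) (inj₂ q) = inj₂ (inj₁ (trans p (sym q)))
    at-shares (inj₂ p) (inj₁ q) = inj₂ (inj₂ (inj₁ (trans p (sym q))))
    at-shares (inj₂ p) (inj₂ q) = inj₂ (inj₂ (inj₂ (trans p (sym q))))

    straddling-width-apart : ∀ {e f} → e ∈ᴸ F → f ∈ᴸ F → ¬ At e → ¬ At f → e ≢ f →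
                             Apart 2 (width e) (width f)
    straddling-width-apart {e} {f} e∈ f∈ ¬at-e ¬at-f e≢f with shares⊎independent e f
    ... | inj₁ (inj₁ lo≡lo) = shares-lo⇒width-apart e≢f (mono e f (F⊆E e∈) (F⊆E f∈)) lo≡lo
    ... | inj₁ (inj₂ (inj₁ lo≡hi)) =
      contradiction (<-trans (lo<b e∈ ¬at-e) (b<hi f∈ ¬at-f)) (<-irrefl (cong toℕ lo≡hi))
    ... | inj₁ (inj₂ (inj₂ (inj₁ hi≡lo))) =
      contradiction (<-trans (lo<b f∈ ¬at-f) (b<hi e∈ ¬at-e)) (<-irrefl (sym (cong toℕ hi≡lo)))
    ... | inj₁ (inj₂ (inj₂ (inj₂ hi≡hi))) = shares-hi⇒width-apart e≢f (mono e f (F⊆E e∈) (F⊆E f∈)) hi≡hi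
    ... | inj₂ ind = nested⇒width-apart {e = e} {f} (nested e f (F⊆E e∈) (F⊆E f∈) ind)

    key-apart : ∀ {e f} → e ∈ᴸ F → f ∈ᴸ F → e ≢ f → Apart 2 (key e) (key f)
    key-apart {e} {f} e∈ f∈ e≢f = apart (at? e) (at? f)
      where
      apart : ∀ p q → Apart 2 (keyBy e p) (keyBy f q)
      apart (yes p) (yes q) = shares⇒sum-apart e≢f (mono e f (F⊆E e∈) (F⊆E f∈)) (at-shares {e} {f} p q)
      apart (yes p) (no ¬q) = inj₁ (at<straddling e∈ f∈ p ¬q)
      apart (no ¬p) (yes q) = inj₂ (at<straddling f∈ e∈ q ¬p)
      apart (no ¬p) (no ¬q) = map (+-monoˡ-≤ (suc (A + B))) (+-monoˡ-≤ (suc (A + B)))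
                                  (straddling-width-apart e∈ f∈ ¬p ¬q e≢f)

    -- So `e₀` has the least sum among edges at `b`: those starting there have high end at least
    -- `a`, and for those ending there `a` is the least low end.
    A+B≤sum : ∀ {f} → f ∈ᴸ F → At f → A + B ≤ sum f
    A+B≤sum f∈ (inj₁ refl) = ≤-trans (≤-reflexive (+-comm A B)) (+-monoʳ-≤ B (lo≤hiᶠ e₀∈ f∈))
    A+B≤sum f∈ (inj₂ refl) with least f∈
    ... | inj₁ b<b = contradiction b<b (<-irrefl refl)
    ... | inj₂ (_ , a≤lo) = +-monoˡ-≤ B a≤lo

    width< : ∀ e → suc (width e) ≤ n
    width< e = ≤-<-trans (m∸n≤m _ (toℕ (lo e))) (Fin.toℕ<n (hi e))

    key-within : ∀ {e f} → e ∈ᴸ F → f ∈ᴸ F → key e ≤ key f + n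
    key-within {e} {f} e∈ f∈ = within (at? e) (at? f)
      where
      open ≤-Reasoning
      within : ∀ p q → keyBy e p ≤ keyBy f q + n
      within (yes p) (yes q) = begin
        toℕ (lo e) + toℕ (hi e)  ≤⟨ +-mono-≤ (lo≤hiᶠ e∈ f∈) (Fin.toℕ≤n (hi e)) ⟩
        toℕ (hi f) + n           ≤⟨ +-monoˡ-≤ n (m≤n+m _ (toℕ (lo f))) ⟩
        sum f + n                ∎
      within (yes p) (no ¬q) =
        ≤-trans (m≤n+m _ 2) (≤-trans (at<straddling e∈ f∈ p ¬q) (m≤m+n _ n))
      -- A width is at most `n - 1`; the extra 1 in the shift brings the spread up to `n`.
      within (no ¬p) (yes q) = begin
        width e + suc (A + B)    ≡⟨ +-suc (width e) (A + B) ⟩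
        suc (width e) + (A + B)  ≤⟨ +-mono-≤ (width< e) (A+B≤sum f∈ q) ⟩
        n + sum f                ≡⟨ +-comm n _ ⟩
        sum f + n                ∎
      within (no ¬p) (no ¬q) = begin
        width e + suc (A + B)        ≤⟨ +-monoˡ-≤ _ (<⇒≤ (width< e)) ⟩
        n + suc (A + B)              ≤⟨ +-monoʳ-≤ n (m≤n+m _ (width f)) ⟩
        n + (width f + suc (A + B))  ≡⟨ +-comm n _ ⟩
        width f + suc (A + B) + n    ∎

  nested-order : IsTree → Monochromatic parityColoring → IndependentEdgesAre Nested →
                 order * 2 ≤ 4 + n
  nested-order tree@(_ , _ , acyclic) mono nested with spanningTree H tree
  ... | [] , _ , _ , order≤ = ≤suc⇒*2≤ order≤ z≤n
  ... | e ∷ F , unique , F⊆E , order≤ with lexMinimum e F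
  ... | e₀ , e₀∈ , least = ≤suc⇒*2≤ order≤ (spaced-length 2 n key unique key-within key-apart)
    where open NestedKey acyclic mono nested (e ∷ F) F⊆E e₀ e₀∈ least

-- From rational bounds to the theorem

half<⇒< : ∀ {a k} → + a / 2 <ℚ fromℕ k → a < k * 2
half<⇒< {a} {k} lt = ℤ.drop‿+<+
  (subst₂ ℤ._<_ (ℤ.*-identityʳ (+ a)) (sym (ℤ.pos-* k 2)) (drop-*<* lt))

theorem2p4 : ∀ (n : ℕ) →
    (4 ≤ n → ∃ λ (χ : Coloring n) →
    ¬ ContainsMonochromaticSubtree χ Separated (λ k → ⌈ n /2⌉ + 1 < k))
    × (∃ λ (χ : Coloring n) →
    ¬ ContainsMonochromaticSubtree χ Nested (λ k → + (n + 4) / 2 <ℚ fromℕ k))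
    × (∃ λ (χ : Coloring n) →
    ¬ ContainsMonochromaticSubtree χ Crossing (λ k → + (n + 3) / 2 <ℚ fromℕ k))
theorem2p4 n =
    -- Matching exposes `n` as `suc n′`, so that `⌈ n /2⌉` computes to `suc ⌊ n′ /2⌋`, the successor
    -- form required of the cut.
    (λ { (s≤s {n = n′} _) → halvesColoring ⌈ n /2⌉ ,
         λ (H , tree , mono , separated , large) →
           <⇒≱ large (separated-order H ⌊ n′ /2⌋
             (subst (_≤ ⌈ n /2⌉ + ⌈ n /2⌉) (⌊n/2⌋+⌈n/2⌉≡n n) (+-monoˡ-≤ ⌈ n /2⌉ (⌊n/2⌋≤⌈n/2⌉ n)))
             tree mono separated) })
  , (parityColoring , λ (H , tree , mono , nested , large) →
      <⇒≱ (half<⇒< large) (≤-trans (nested-order H tree mono nested) (≤-reflexive (+-comm 4 n))))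
  , (parityColoring , λ (H , tree , mono , crossing , large) →
      <⇒≱ (half<⇒< large) (≤-trans (crossing-order H tree mono crossing) (≤-reflexive (+-comm 3 n))))
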